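{- Let $G$ be a simple, undirected, connected graph on $N$ vertices with edge set $E$, and let $R=\max_{i,j}R_{ij}$. Then $$R^+(G)\le 2|E|(N-1)R.$$
   Context: For vertices $i,j$ of $G$, $R_{ij}$ denotes the effective resistance between $i$ and $j$ when every edge of $G$ is a unit resistor. The additive degree-Kirchhoff index is $R^+(G)=\sum_{i<j}(d_i+d_j)R_{ij}$, where $d_i$ is the degree of vertex $i$. -}

module Defs where

open import Data.Bool.Base using (if_then_else_)
open import Data.Fin.Base using (Fin; zero; suc; _<_)
open import Data.Fin.Properties using (_≟_; _<?_; any?)
import Data.Integer.Base as ℤ
open import Data.List.Base as List
  using (List; length; filter; foldr; allFin; cartesianProduct)
open import Data.Nat.Base as ℕ using (ℕ; zero; suc)
open import Data.Product.Base using (∃; ∃₂; _×_; _,_; proj₁; proj₂; uncurry)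
open import Data.Rational.Base as ℚ
  using (ℚ; 0ℚ; 1ℚ; _+_; _*_; _-_; -_; 1/_; _/_; _≤_)
import Data.Rational.Properties as ℚₚ
open import Data.Rational.Solver using (module +-*-Solver)
open import Data.Sum.Base using (_⊎_; inj₁; inj₂)
open import Level using (0ℓ)
open import Relation.Binary.Construct.Closure.ReflexiveTransitive using (Star; ε; _◅_)
open import Relation.Binary.Core using (Rel)
open import Relation.Binary.Definitions using (Decidable; Symmetric; Irreflexive)
open import Relation.Binary.PropositionalEquality
  using (_≡_; _≢_; refl; sym; trans; cong; cong₂; module ≡-Reasoning)
open import Relation.Nullary.Decidable using (yes; no; does; ¬?; decidable-stable)
open import Relation.Nullary.Negation using (contradiction)

open import Algebra.Bundles using (CommutativeRing)
open import Algebra.Properties.Semiring.Sum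
  (CommutativeRing.semiring ℚₚ.+-*-commutativeRing)
  using (sum; sum-syntax; sum-cong-≗; ∑-distrib-+; ∑-comm; *-distribˡ-sum)

open +-*-Solver using (solve; _:=_; _:+_; _:*_; _:-_; :-_; con)

record SimpleGraph (N : ℕ) : Set₁ where
  infix 4 _~_ _~?_
  field
    _~_    : Rel (Fin N) 0ℓ
    _~?_   : Decidable _~_
    symm   : Symmetric _~_
    irrefl : Irreflexive _≡_ _~_

Connected : ∀ {N} → SimpleGraph N → Set
Connected G = ∀ i j → Star _~_ i j
  where open SimpleGraph G

pairs : ∀ N → List (Fin N × Fin N)
pairs N = filter (uncurry _<?_) (cartesianProduct (allFin N) (allFin N))

-- Each edge is listed once, with its smaller endpoint first.
edges : ∀ {N} → SimpleGraph N → List (Fin N × Fin N)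
edges {N} G = filter (uncurry _~?_) (pairs N)
  where open SimpleGraph G

∣E∣ : ∀ {N} → SimpleGraph N → ℕ
∣E∣ G = length (edges G)

degree : ∀ {N} → SimpleGraph N → Fin N → ℕ
degree {N} G i = length (filter (i ~?_) (allFin N))
  where open SimpleGraph G

fromℕ : ℕ → ℚ
fromℕ n = ℤ.+ n / 1

δ : ∀ {N} → Fin N → Fin N → ℚ
δ i j = if does (i ≟ j) then 1ℚ else 0ℚ

module _ {N} (G : SimpleGraph N) where
  open SimpleGraph G

  -- Ohm's law with unit resistance on every edge: the current from k to l under the potential v.
  current : (Fin N → ℚ) → Fin N → Fin N → ℚ
  current v k l = if does (k ~? l) then v k - v l else 0ℚ

  -- Kirchhoff's current law when a unit current enters at i and leaves at j.
  IsUnitFlowPotential : Fin N → Fin N → (Fin N → ℚ) → Set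
  IsUnitFlowPotential i j v = ∀ k → ∑[ l < N ] current v k l ≡ δ k i - δ k j

private
  module Sums where
    open ≡-Reasoning

    ∑0 : ∀ {n} {f : Fin n → ℚ} → (∀ i → f i ≡ 0ℚ) → sum f ≡ 0ℚ
    ∑0 {zero}  h = refl
    ∑0 {suc n} h = cong₂ _+_ (h zero) (∑0 (λ i → h (suc i)))

    ∑-*ˡ : ∀ {n} x (f : Fin n → ℚ) → ∑[ i < n ] (x * f i) ≡ x * sum f
    ∑-*ˡ x f = sym (*-distribˡ-sum x f)

    ∑-sub : ∀ {n} (f g : Fin n → ℚ) → ∑[ i < n ] (f i - g i) ≡ sum f - sum g
    ∑-sub {n} f g = begin
      ∑[ i < n ] (f i - g i)
        ≡⟨ ∑-distrib-+ f (λ i → - g i) ⟩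
      sum f + ∑[ i < n ] (- g i)
        ≡⟨ cong (sum f +_) (sum-cong-≗ (λ i → neg (g i))) ⟩
      sum f + ∑[ i < n ] (- 1ℚ * g i)
        ≡⟨ cong (sum f +_) (∑-*ˡ (- 1ℚ) g) ⟩
      sum f + - 1ℚ * sum g
        ≡⟨ cong (sum f +_) (sym (neg (sum g))) ⟩
      sum f - sum g ∎
      where
      neg : ∀ x → - x ≡ - 1ℚ * x
      neg = solve 1 (λ x → :- x := con (- 1ℚ) :* x) refl

    δ-suc : ∀ {n} (i j : Fin n) → δ (suc i) (suc j) ≡ δ i j
    δ-suc i j with i ≟ j
    ... | yes _ = refl
    ... | no  _ = refl

    ∑-δ : ∀ {n} i (f : Fin n → ℚ) → ∑[ k < n ] (δ k i * f k) ≡ f i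
    ∑-δ zero f = trans
      (cong₂ _+_ (ℚₚ.*-identityˡ (f zero)) (∑0 (λ k → ℚₚ.*-zeroˡ (f (suc k)))))
      (ℚₚ.+-identityʳ (f zero))
    ∑-δ (suc i) f = trans
      (cong₂ _+_ (ℚₚ.*-zeroˡ (f zero))
        (trans (sum-cong-≗ (λ k → cong (_* f (suc k)) (δ-suc k i)))
               (∑-δ i (λ k → f (suc k)))))
      (ℚₚ.+-identityˡ (f (suc i)))

    0≤sq : ∀ p → 0ℚ ≤ p * p
    0≤sq p with ℚₚ.≤-total 0ℚ p
    ... | inj₁ 0≤p = ℚₚ.nonNegative⁻¹ (p * p)
      {{ℚₚ.nonNeg*nonNeg⇒nonNeg p {{ℚ.nonNegative 0≤p}} p {{ℚ.nonNegative 0≤p}}}}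
    ... | inj₂ p≤0 = ℚₚ.nonNegative⁻¹ (p * p)
      {{ℚₚ.nonPos*nonPos⇒nonPos p {{ℚ.nonPositive p≤0}} p {{ℚ.nonPositive p≤0}}}}

    sq≡0 : ∀ p → p * p ≡ 0ℚ → p ≡ 0ℚ
    sq≡0 p pp≡0 with p ℚₚ.≟ 0ℚ
    ... | yes p≡0 = p≡0
    ... | no  p≢0 = begin
      p               ≡⟨ ℚₚ.*-identityˡ p ⟨
      1ℚ * p          ≡⟨ cong (_* p) (ℚₚ.*-inverseˡ p) ⟨
      1/ p * p * p    ≡⟨ ℚₚ.*-assoc (1/ p) p p ⟩
      1/ p * (p * p)  ≡⟨ cong (1/ p *_) pp≡0 ⟩
      1/ p * 0ℚ       ≡⟨ ℚₚ.*-zeroʳ (1/ p) ⟩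
      0ℚ              ∎
      where instance _ = ℚ.≢-nonZero p≢0

    ∑-nonNeg : ∀ {n} (f : Fin n → ℚ) → (∀ i → 0ℚ ≤ f i) → 0ℚ ≤ sum f
    ∑-nonNeg {zero}  f h = ℚₚ.≤-refl
    ∑-nonNeg {suc n} f h = ℚₚ.+-mono-≤ (h zero) (∑-nonNeg _ (λ i → h (suc i)))

    ∑-nonNeg≡0 : ∀ {n} (f : Fin n → ℚ) → (∀ i → 0ℚ ≤ f i) → sum f ≡ 0ℚ → ∀ i → f i ≡ 0ℚ
    ∑-nonNeg≡0 {suc n} f h eq = λ where
        zero    → f₀≡0
        (suc i) → ∑-nonNeg≡0 (λ k → f (suc k)) (λ k → h (suc k)) rest≡0 i
      where
      rest : ℚ
      rest = ∑[ k < n ] f (suc k)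

      f₀≤0 : f zero ≤ 0ℚ
      f₀≤0 = ℚₚ.≤-trans (ℚₚ.≤-reflexive (sym (ℚₚ.+-identityʳ (f zero))))
        (ℚₚ.≤-trans (ℚₚ.+-monoʳ-≤ (f zero) (∑-nonNeg (λ k → f (suc k)) (λ k → h (suc k))))
          (ℚₚ.≤-reflexive eq))

      f₀≡0 : f zero ≡ 0ℚ
      f₀≡0 = ℚₚ.≤-antisym f₀≤0 (h zero)

      rest≡0 : rest ≡ 0ℚ
      rest≡0 = trans (sym (ℚₚ.+-identityˡ rest)) (trans (cong (_+ rest) (sym f₀≡0)) eq)

  module LinearSystem where
    open Sums
    open ≡-Reasoning

    Solution : ∀ {m n} → (Fin m → Fin n → ℚ) → (Fin m → ℚ) → Set
    Solution {m} {n} A b = ∃ λ (x : Fin n → ℚ) → ∀ k → ∑[ l < n ] (A k l * x l) ≡ b k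

    -- A combination of the equations that reads 0 = c with c ≢ 0.
    Obstruction : ∀ {m n} → (Fin m → Fin n → ℚ) → (Fin m → ℚ) → Set
    Obstruction {m} {n} A b = ∃ λ (y : Fin m → ℚ) →
      (∀ l → ∑[ k < m ] (y k * A k l) ≡ 0ℚ) × ∑[ k < m ] (y k * b k) ≢ 0ℚ

    -- Gaussian elimination.
    fredholm : ∀ {m n} (A : Fin m → Fin n → ℚ) (b : Fin m → ℚ) → Solution A b ⊎ Obstruction A b
    fredholm {m} {zero} A b with any? (λ k → ¬? (b k ℚₚ.≟ 0ℚ))
    ... | yes (k , bk≢0) = inj₂
      ((λ r → δ r k) , (λ ()) , λ eq → bk≢0 (trans (sym (∑-δ k b)) eq))
    ... | no none = inj₁
      ((λ ()) , λ k → sym (decidable-stable (b k ℚₚ.≟ 0ℚ) (λ bk≢0 → none (k , bk≢0))))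
    fredholm {m} {suc n} A b with any? (λ k → ¬? (A k zero ℚₚ.≟ 0ℚ))
    ... | no none = lift (fredholm (λ k l → A k (suc l)) b)
      where
      col≡0 : ∀ k → A k zero ≡ 0ℚ
      col≡0 k = decidable-stable (A k zero ℚₚ.≟ 0ℚ) (λ a≢0 → none (k , a≢0))

      lift : Solution (λ k l → A k (suc l)) b ⊎ Obstruction (λ k l → A k (suc l)) b →
             Solution A b ⊎ Obstruction A b
      lift (inj₁ (x , p)) = inj₁ (x′ , λ k →
        trans (cong₂ _+_ (ℚₚ.*-zeroʳ (A k zero)) (p k)) (ℚₚ.+-identityˡ (b k)))
        where
        x′ : Fin (suc n) → ℚ
        x′ zero    = 0ℚ
        x′ (suc l) = x l
      lift (inj₂ (y , p , q)) = inj₂ (y , p′ , q)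
        where
        p′ : ∀ l → ∑[ k < m ] (y k * A k l) ≡ 0ℚ
        p′ zero    = ∑0 (λ k → trans (cong (y k *_) (col≡0 k)) (ℚₚ.*-zeroʳ (y k)))
        p′ (suc l) = p l
    ... | yes (p , a≢0) = lift (fredholm A′ b′)
      where
      instance _ = ℚ.≢-nonZero a≢0

      a⁻¹ : ℚ
      a⁻¹ = 1/ A p zero

      f : Fin m → ℚ
      f k = A k zero * a⁻¹

      f*a : ∀ k → f k * A p zero ≡ A k zero
      f*a k = trans (ℚₚ.*-assoc (A k zero) a⁻¹ (A p zero))
        (trans (cong (A k zero *_) (ℚₚ.*-inverseˡ (A p zero))) (ℚₚ.*-identityʳ (A k zero)))

      reduce : (Fin m → ℚ) → Fin m → ℚ
      reduce c k = c k - f k * c p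

      A′ : Fin m → Fin n → ℚ
      A′ k l = reduce (λ r → A r (suc l)) k

      b′ : Fin m → ℚ
      b′ = reduce b

      module _ (x : Fin n → ℚ) (sol : ∀ k → ∑[ l < n ] (A′ k l * x l) ≡ b′ k) where
        S : Fin m → ℚ
        S k = ∑[ l < n ] (A k (suc l) * x l)

        S-reduce : ∀ k → S k - f k * S p ≡ b k - f k * b p
        S-reduce k = begin
          S k - f k * S p
            ≡⟨ cong (λ t → S k - t) (∑-*ˡ (f k) (λ l → A p (suc l) * x l)) ⟨
          S k - ∑[ l < n ] (f k * (A p (suc l) * x l))
            ≡⟨ ∑-sub (λ l → A k (suc l) * x l) (λ l → f k * (A p (suc l) * x l)) ⟨
          ∑[ l < n ] (A k (suc l) * x l - f k * (A p (suc l) * x l))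
            ≡⟨ sum-cong-≗ (λ l → solve 4 (λ u g v z → u :* z :- g :* (v :* z) := (u :- g :* v) :* z)
                 refl (A k (suc l)) (f k) (A p (suc l)) (x l)) ⟩
          ∑[ l < n ] (A′ k l * x l)
            ≡⟨ sol k ⟩
          b k - f k * b p ∎

        extend : Fin (suc n) → ℚ
        extend zero    = a⁻¹ * (b p - S p)
        extend (suc l) = x l

        extend-sol : ∀ k → ∑[ l < suc n ] (A k l * extend l) ≡ b k
        extend-sol k = begin
          A k zero * (a⁻¹ * (b p - S p)) + S k
            ≡⟨ solve 5 (λ u i bp sp s → u :* (i :* (bp :- sp)) :+ s
                                     := u :* i :* bp :+ (s :- u :* i :* sp))
                 refl (A k zero) a⁻¹ (b p) (S p) (S k) ⟩
          f k * b p + (S k - f k * S p)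
            ≡⟨ cong (_+_ (f k * b p)) (S-reduce k) ⟩
          f k * b p + (b k - f k * b p)
            ≡⟨ solve 2 (λ u v → u :+ (v :- u) := v) refl (f k * b p) (b k) ⟩
          b k ∎

      module _ (y : Fin m → ℚ) where
        w : ℚ
        w = ∑[ k < m ] (y k * f k)

        y′ : Fin m → ℚ
        y′ k = y k - w * δ k p

        y′-comb : ∀ c → ∑[ k < m ] (y′ k * c k) ≡ ∑[ k < m ] (y k * reduce c k)
        y′-comb c = begin
          ∑[ k < m ] (y′ k * c k)
            ≡⟨ sum-cong-≗ (λ k → solve 4 (λ u v d z → (u :- v :* d) :* z := u :* z :- v :* (d :* z))
                 refl (y k) w (δ k p) (c k)) ⟩
          ∑[ k < m ] (y k * c k - w * (δ k p * c k))
            ≡⟨ ∑-sub (λ k → y k * c k) (λ k → w * (δ k p * c k)) ⟩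
          yc - ∑[ k < m ] (w * (δ k p * c k))
            ≡⟨ cong (λ t → yc - t) (trans (∑-*ˡ w (λ k → δ k p * c k)) (cong (w *_) (∑-δ p c))) ⟩
          yc - w * c p
            ≡⟨ cong (λ t → yc - t) (trans (ℚₚ.*-comm w (c p)) (sym (∑-*ˡ (c p) (λ k → y k * f k)))) ⟩
          yc - ∑[ k < m ] (c p * (y k * f k))
            ≡⟨ ∑-sub (λ k → y k * c k) (λ k → c p * (y k * f k)) ⟨
          ∑[ k < m ] (y k * c k - c p * (y k * f k))
            ≡⟨ sum-cong-≗ (λ k → solve 4 (λ u z zp g → u :* z :- zp :* (u :* g) := u :* (z :- g :* zp))
                 refl (y k) (c k) (c p) (f k)) ⟩
          ∑[ k < m ] (y k * reduce c k) ∎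
          where
          yc : ℚ
          yc = ∑[ k < m ] (y k * c k)

        column₀ : ∑[ k < m ] (y k * reduce (λ r → A r zero) k) ≡ 0ℚ
        column₀ = ∑0 (λ k → trans
          (cong (λ t → y k * (A k zero - t)) (f*a k))
          (solve 2 (λ u v → u :* (v :- v) := con 0ℚ) refl (y k) (A k zero)))

      lift : Solution A′ b′ ⊎ Obstruction A′ b′ → Solution A b ⊎ Obstruction A b
      lift (inj₁ (x , sol))      = inj₁ (extend x sol , extend-sol x sol)
      lift (inj₂ (y , yA , yb≢0)) = inj₂ (y′ y , y′A , λ eq → yb≢0 (trans (sym (y′-comb y b)) eq))
        where
        y′A : ∀ l → ∑[ k < m ] (y′ y k * A k l) ≡ 0ℚ
        y′A zero    = trans (y′-comb y (λ r → A r zero)) (column₀ y)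
        y′A (suc l) = trans (y′-comb y (λ r → A r (suc l))) (yA l)

module _ {N} (G : SimpleGraph N) where
  open SimpleGraph G
  open Sums
  open ≡-Reasoning

  private
    c : Fin N → Fin N → ℚ
    c k l = if does (k ~? l) then 1ℚ else 0ℚ

    c-comm : ∀ k l → c k l ≡ c l k
    c-comm k l with k ~? l | l ~? k
    ... | yes _   | yes _   = refl
    ... | no  _   | no  _   = refl
    ... | yes k~l | no  l≁k = contradiction (symm k~l) l≁k
    ... | no  k≁l | yes l~k = contradiction (symm l~k) k≁l

    c-adj : ∀ {k l} → k ~ l → c k l ≡ 1ℚ
    c-adj {k} {l} k~l with k ~? l
    ... | yes _   = refl
    ... | no  k≁l = contradiction k~l k≁l

    current-c : ∀ v k l → current G v k l ≡ c k l * (v k - v l)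
    current-c v k l with k ~? l
    ... | yes _ = sym (ℚₚ.*-identityˡ (v k - v l))
    ... | no  _ = sym (ℚₚ.*-zeroˡ (v k - v l))

    laplacian : Fin N → Fin N → ℚ
    laplacian k l = δ l k * sum (c k) - c k l

    laplacian-comm : ∀ k l → laplacian k l ≡ laplacian l k
    laplacian-comm k l = cong₂ _-_ diagonal (c-comm k l)
      where
      diagonal : δ l k * sum (c k) ≡ δ k l * sum (c l)
      diagonal with l ≟ k | k ≟ l
      ... | yes l≡k | yes _   = cong (λ t → 1ℚ * sum (c t)) (sym l≡k)
      ... | no  _   | no  _   = trans (ℚₚ.*-zeroˡ (sum (c k))) (sym (ℚₚ.*-zeroˡ (sum (c l))))
      ... | yes l≡k | no  k≢l = contradiction (sym l≡k) k≢l
      ... | no  l≢k | yes k≡l = contradiction (sym k≡l) l≢k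

    outflow : ∀ v k → ∑[ l < N ] (laplacian k l * v l) ≡ ∑[ l < N ] current G v k l
    outflow v k = begin
      ∑[ l < N ] (laplacian k l * v l)
        ≡⟨ sum-cong-≗ (λ l → solve 4 (λ d s e z → (d :* s :- e) :* z := s :* (d :* z) :- e :* z)
             refl (δ l k) (sum (c k)) (c k l) (v l)) ⟩
      ∑[ l < N ] (sum (c k) * (δ l k * v l) - c k l * v l)
        ≡⟨ ∑-sub (λ l → sum (c k) * (δ l k * v l)) (λ l → c k l * v l) ⟩
      ∑[ l < N ] (sum (c k) * (δ l k * v l)) - cv
        ≡⟨ cong (_- cv) (trans (∑-*ˡ (sum (c k)) (λ l → δ l k * v l))
                               (cong (sum (c k) *_) (∑-δ k v))) ⟩
      sum (c k) * v k - cv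
        ≡⟨ cong (_- cv) (trans (ℚₚ.*-comm (sum (c k)) (v k)) (sym (∑-*ˡ (v k) (c k)))) ⟩
      ∑[ l < N ] (v k * c k l) - cv
        ≡⟨ ∑-sub (λ l → v k * c k l) (λ l → c k l * v l) ⟨
      ∑[ l < N ] (v k * c k l - c k l * v l)
        ≡⟨ sum-cong-≗ (λ l → trans
             (solve 3 (λ u e z → u :* e :- e :* z := e :* (u :- z)) refl (v k) (c k l) (v l))
             (sym (current-c v k l))) ⟩
      ∑[ l < N ] current G v k l ∎
      where
      cv : ℚ
      cv = ∑[ l < N ] (c k l * v l)

    module _ (y : Fin N → ℚ) (harmonic : ∀ k → ∑[ l < N ] current G y k l ≡ 0ℚ) where

      power : Fin N → Fin N → ℚ
      power k l = c k l * ((y k - y l) * (y k - y l))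

      power-nonNeg : ∀ k l → 0ℚ ≤ power k l
      power-nonNeg k l with k ~? l
      ... | yes _ = ℚₚ.≤-trans (0≤sq (y k - y l)) (ℚₚ.≤-reflexive (sym (ℚₚ.*-identityˡ _)))
      ... | no  _ = ℚₚ.≤-reflexive (sym (ℚₚ.*-zeroˡ ((y k - y l) * (y k - y l))))

      h : Fin N → Fin N → ℚ
      h k l = y k * current G y k l

      ∑∑h≡0 : ∑[ k < N ] ∑[ l < N ] h k l ≡ 0ℚ
      ∑∑h≡0 = ∑0 (λ k → trans (∑-*ˡ (y k) (current G y k))
        (trans (cong (y k *_) (harmonic k)) (ℚₚ.*-zeroʳ (y k))))

      power-h : ∀ k l → power k l ≡ h k l + h l k
      power-h k l = begin
        c k l * ((y k - y l) * (y k - y l))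
          ≡⟨ solve 3 (λ e u v → e :* ((u :- v) :* (u :- v))
                             := u :* (e :* (u :- v)) :+ v :* (e :* (v :- u)))
               refl (c k l) (y k) (y l) ⟩
        y k * (c k l * (y k - y l)) + y l * (c k l * (y l - y k))
          ≡⟨ cong (λ t → y k * (c k l * (y k - y l)) + y l * (t * (y l - y k))) (c-comm k l) ⟩
        y k * (c k l * (y k - y l)) + y l * (c l k * (y l - y k))
          ≡⟨ cong₂ (λ s t → y k * s + y l * t) (current-c y k l) (current-c y l k) ⟨
        h k l + h l k ∎

      total-power : ∑[ k < N ] ∑[ l < N ] power k l ≡ 0ℚ
      total-power = begin
        ∑[ k < N ] ∑[ l < N ] power k l
          ≡⟨ sum-cong-≗ (λ k → trans (sum-cong-≗ (power-h k)) (∑-distrib-+ (h k) (λ l → h l k))) ⟩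
        ∑[ k < N ] (sum (h k) + ∑[ l < N ] h l k)
          ≡⟨ ∑-distrib-+ (λ k → sum (h k)) (λ k → ∑[ l < N ] h l k) ⟩
        ∑[ k < N ] sum (h k) + ∑[ k < N ] ∑[ l < N ] h l k
          ≡⟨ cong₂ _+_ ∑∑h≡0 (trans (∑-comm (λ k l → h l k)) ∑∑h≡0) ⟩
        0ℚ ∎

      power≡0 : ∀ k l → power k l ≡ 0ℚ
      power≡0 k = ∑-nonNeg≡0 (power k) (power-nonNeg k)
        (∑-nonNeg≡0 (λ r → sum (power r)) (λ r → ∑-nonNeg (power r) (power-nonNeg r)) total-power k)

      edge-constant : ∀ {k l} → k ~ l → y k ≡ y l
      edge-constant {k} {l} k~l = begin
        y k                ≡⟨ solve 2 (λ u v → u := (u :- v) :+ v) refl (y k) (y l) ⟩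
        (y k - y l) + y l  ≡⟨ cong (_+ y l) (sq≡0 (y k - y l) sq) ⟩
        0ℚ + y l           ≡⟨ ℚₚ.+-identityˡ (y l) ⟩
        y l                ∎
        where
        sq : (y k - y l) * (y k - y l) ≡ 0ℚ
        sq = trans (sym (ℚₚ.*-identityˡ _))
          (trans (cong (_* ((y k - y l) * (y k - y l))) (sym (c-adj k~l))) (power≡0 k l))

      path-constant : ∀ {k l} → Star _~_ k l → y k ≡ y l
      path-constant ε           = refl
      path-constant (k~m ◅ m⋯l) = trans (edge-constant k~m) (path-constant m⋯l)

  unitFlowPotential : Connected G → ∀ i j → ∃ (IsUnitFlowPotential G i j)
  unitFlowPotential connected i j with LinearSystem.fredholm laplacian (λ k → δ k i - δ k j)
  ... | inj₁ (v , sol) = v , λ k → trans (sym (outflow v k)) (sol k)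
  ... | inj₂ (y , yL≡0 , yb≢0) = contradiction yb≡0 yb≢0
    where
    harmonic : ∀ k → ∑[ l < N ] current G y k l ≡ 0ℚ
    harmonic k = begin
      ∑[ l < N ] current G y k l
        ≡⟨ outflow y k ⟨
      ∑[ l < N ] (laplacian k l * y l)
        ≡⟨ sum-cong-≗ (λ l → trans (ℚₚ.*-comm (laplacian k l) (y l))
             (cong (y l *_) (laplacian-comm k l))) ⟩
      ∑[ l < N ] (y l * laplacian l k)
        ≡⟨ yL≡0 k ⟩
      0ℚ ∎

    yb≡0 : ∑[ k < N ] (y k * (δ k i - δ k j)) ≡ 0ℚ
    yb≡0 = begin
      ∑[ k < N ] (y k * (δ k i - δ k j))
        ≡⟨ sum-cong-≗ (λ k → solve 3 (λ u d e → u :* (d :- e) := d :* u :- e :* u)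
             refl (y k) (δ k i) (δ k j)) ⟩
      ∑[ k < N ] (δ k i * y k - δ k j * y k)
        ≡⟨ ∑-sub (λ k → δ k i * y k) (λ k → δ k j * y k) ⟩
      ∑[ k < N ] (δ k i * y k) - ∑[ k < N ] (δ k j * y k)
        ≡⟨ cong₂ _-_ (∑-δ i y) (∑-δ j y) ⟩
      y i - y j
        ≡⟨ cong (_- y j) (path-constant y harmonic (connected i j)) ⟩
      y j - y j
        ≡⟨ ℚₚ.+-inverseʳ (y j) ⟩
      0ℚ ∎

  -- The system is rational, so its potentials may be taken in ℚ rather than ℝ.
  effectiveResistance : Connected G → Fin N → Fin N → ℚ
  effectiveResistance connected i j = v i - v j
    where v = proj₁ (unitFlowPotential connected i j)

  -- The choice of potential is immaterial.
  effectiveResistance-unique : ∀ (connected : Connected G) i j {w} →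
    IsUnitFlowPotential G i j w → effectiveResistance connected i j ≡ w i - w j
  effectiveResistance-unique connected i j {w} w-flow = begin
    v i - v j
      ≡⟨ solve 4 (λ a b c d → a :- b := (a :- c) :+ (c :- b)) refl (v i) (v j) (w i) (w j) ⟩
    (v i - w i) + (w i - v j)
      ≡⟨ cong (_+ (w i - v j)) (path-constant (λ k → v k - w k) harmonic (connected i j)) ⟩
    (v j - w j) + (w i - v j)
      ≡⟨ solve 3 (λ b c d → (b :- d) :+ (c :- b) := c :- d) refl (v j) (w i) (w j) ⟩
    w i - w j ∎
    where
    v : Fin N → ℚ
    v = proj₁ (unitFlowPotential connected i j)

    current-sub : ∀ k l → current G (λ r → v r - w r) k l ≡ current G v k l - current G w k l
    current-sub k l with k ~? l
    ... | yes _ = solve 4 (λ a b c d → (a :- c) :- (b :- d) := (a :- b) :- (c :- d))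
                    refl (v k) (v l) (w k) (w l)
    ... | no  _ = refl

    harmonic : ∀ k → ∑[ l < N ] current G (λ r → v r - w r) k l ≡ 0ℚ
    harmonic k = begin
      ∑[ l < N ] current G (λ r → v r - w r) k l
        ≡⟨ sum-cong-≗ (current-sub k) ⟩
      ∑[ l < N ] (current G v k l - current G w k l)
        ≡⟨ ∑-sub (current G v k) (current G w k) ⟩
      ∑[ l < N ] current G v k l - ∑[ l < N ] current G w k l
        ≡⟨ cong₂ _-_ (proj₂ (unitFlowPotential connected i j) k) (w-flow k) ⟩
      (δ k i - δ k j) - (δ k i - δ k j)
        ≡⟨ ℚₚ.+-inverseʳ (δ k i - δ k j) ⟩
      0ℚ ∎

R⁺ : ∀ {N} (G : SimpleGraph N) → Connected G → ℚ
R⁺ {N} G connected = foldr _+_ 0ℚ (List.map term (pairs N))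
  where
  term : Fin N × Fin N → ℚ
  term (i , j) = fromℕ (degree G i ℕ.+ degree G j) * effectiveResistance G connected i j

IsMaximum : ∀ {N} → (Fin N → Fin N → ℚ) → ℚ → Set
IsMaximum f M = (∃₂ λ i j → f i j ≡ M) × (∀ i j → f i j ≤ M)

{-# OPTIONS --safe #-}

-- Every summand satisfies (dᵢ + dⱼ) Rᵢⱼ ≤ (dᵢ + dⱼ) R, so only ∑_{i<j} (dᵢ + dⱼ) has to be evaluated.
-- Splitting a sum over all (i , j) into i < j, j < i and i = j gives
-- ∑ᵢ ∑ⱼ f i j = ∑_{i<j} (f i j + f j i) + ∑ᵢ f i i.  For f i j = dᵢ this says
-- N ∑ d = ∑_{i<j} (dᵢ + dⱼ) + ∑ d, and for the adjacency matrix it is the handshake lemma ∑ d = 2|E|.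
module Submission where

open import Defs
open import Data.Nat.Base using (ℕ; _*_; _∸_)
open import Data.Rational.Base as ℚ using (ℚ; _≤_)

open import Data.Bool.Base using (true; false; if_then_else_)
open import Data.Fin.Base using (Fin; zero; suc)
open import Data.Fin.Properties using (_≟_; _<?_; <-cmp)
import Data.Integer.Base as ℤ
import Data.Integer.Properties as ℤₚ
open import Data.List.Base as List
  using (List; []; _∷_; length; filter; foldr; allFin; tabulate; cartesianProduct)
open import Data.List.Properties using (map-∘; map-++; map-cong)
open import Data.Nat.Base using (zero; suc; _+_)
open import Data.Nat.Coprimality using (1-coprimeTo) renaming (sym to coprime-sym)
import Data.Nat.ListAction as ListAction
open import Data.Nat.ListAction.Properties using (sum-++)
open import Data.Nat.Properties
  using (+-0-commutativeMonoid; +-comm; +-identityʳ; *-comm; *-zeroʳ; *-distribˡ-+; m+n∸n≡m)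
open import Data.Product.Base using (_×_; _,_; uncurry)
open import Data.Rational.Base using (0ℚ; mkℚ)
import Data.Rational.Properties as ℚₚ
open import Function.Base using (id; _∘_)
open import Relation.Binary.Definitions using (tri<; tri≈; tri>)
open import Relation.Binary.PropositionalEquality
  using (_≡_; refl; sym; trans; cong; cong₂; subst; module ≡-Reasoning)
open import Relation.Nullary.Decidable using (Dec; yes; no; does; dec-true; dec-false)
open import Relation.Nullary.Negation using (contradiction)
open import Relation.Unary using (Pred; Decidable)

open import Algebra.Properties.CommutativeMonoid.Sum +-0-commutativeMonoid
  using (sum; sum-syntax; sum-cong-≗; sum-replicate-zero; ∑-distrib-+; ∑-comm)

-- Natural-number sums over lists.

infixr 10 [_]·_

-- An Iverson bracket as a weight. It inspects only `does P?`, as `filter` does.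
[_]·_ : ∀ {p} {P : Set p} → Dec P → ℕ → ℕ
[ P? ]· n = if does P? then n else 0

module _ {a} {A : Set a} where

  ∑ˡ : List A → (A → ℕ) → ℕ
  ∑ˡ xs f = ListAction.sum (List.map f xs)

  ∑ˡ-filter : ∀ {p} {P : Pred A p} (P? : Decidable P) f xs →
              ∑ˡ (filter P? xs) f ≡ ∑ˡ xs (λ x → [ P? x ]· f x)
  ∑ˡ-filter P? f []       = refl
  ∑ˡ-filter P? f (x ∷ xs) with does (P? x)
  ... | true  = cong (f x +_) (∑ˡ-filter P? f xs)
  ... | false = ∑ˡ-filter P? f xs

  length-∑ˡ : ∀ (xs : List A) → length xs ≡ ∑ˡ xs (λ _ → 1)
  length-∑ˡ []       = refl
  length-∑ˡ (_ ∷ xs) = cong suc (length-∑ˡ xs)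

  -- Both `degree` and `∣E∣` are lengths of filtered lists; this turns them into sums of indicators.
  length-filter-∑ˡ : ∀ {p} {P : Pred A p} (P? : Decidable P) xs →
                     length (filter P? xs) ≡ ∑ˡ xs (λ x → [ P? x ]· 1)
  length-filter-∑ˡ P? xs = trans (length-∑ˡ (filter P? xs)) (∑ˡ-filter P? (λ _ → 1) xs)

  ∑ˡ-cong : ∀ {f g : A → ℕ} xs → (∀ x → f x ≡ g x) → ∑ˡ xs f ≡ ∑ˡ xs g
  ∑ˡ-cong xs f≗g = cong ListAction.sum (map-cong f≗g xs)

  ∑ˡ-*ˡ : ∀ c (f : A → ℕ) xs → ∑ˡ xs (λ x → c * f x) ≡ c * ∑ˡ xs f
  ∑ˡ-*ˡ c f []       = sym (*-zeroʳ c)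
  ∑ˡ-*ˡ c f (x ∷ xs) = trans (cong (c * f x +_) (∑ˡ-*ˡ c f xs)) (sym (*-distribˡ-+ c (f x) _))

  ∑ˡ-tabulate : ∀ {n} (g : Fin n → A) f → ∑ˡ (tabulate g) f ≡ ∑[ i < n ] f (g i)
  ∑ˡ-tabulate {zero}  g f = refl
  ∑ˡ-tabulate {suc n} g f = cong (f (g zero) +_) (∑ˡ-tabulate (g ∘ suc) f)

∑ˡ-cartesianProduct : ∀ {a b} {A : Set a} {B : Set b} (f : A × B → ℕ) xs ys →
  ∑ˡ (cartesianProduct xs ys) f ≡ ∑ˡ xs (λ x → ∑ˡ ys (λ y → f (x , y)))
∑ˡ-cartesianProduct f []       ys = refl
∑ˡ-cartesianProduct f (x ∷ xs) ys = begin
  ∑ˡ (List.map (x ,_) ys List.++ cartesianProduct xs ys) f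
    ≡⟨ cong ListAction.sum (map-++ f (List.map (x ,_) ys) _) ⟩
  ListAction.sum (List.map f (List.map (x ,_) ys) List.++ List.map f (cartesianProduct xs ys))
    ≡⟨ sum-++ (List.map f (List.map (x ,_) ys)) _ ⟩
  ∑ˡ (List.map (x ,_) ys) f + ∑ˡ (cartesianProduct xs ys) f
    ≡⟨ cong₂ _+_ (cong ListAction.sum (sym (map-∘ ys))) (∑ˡ-cartesianProduct f xs ys) ⟩
  ∑ˡ ys (λ y → f (x , y)) + ∑ˡ xs (λ x → ∑ˡ ys (λ y → f (x , y))) ∎
  where open ≡-Reasoning

∑ˡ-pairs : ∀ n (f : Fin n × Fin n → ℕ) →
           ∑ˡ (pairs n) f ≡ ∑[ i < n ] ∑[ j < n ] [ i <? j ]· f (i , j)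
∑ˡ-pairs n f = begin
  ∑ˡ (pairs n) f
    ≡⟨ ∑ˡ-filter (uncurry _<?_) f (cartesianProduct (allFin n) (allFin n)) ⟩
  ∑ˡ (cartesianProduct (allFin n) (allFin n)) g
    ≡⟨ ∑ˡ-cartesianProduct g (allFin n) (allFin n) ⟩
  ∑ˡ (allFin n) (λ i → ∑ˡ (allFin n) (λ j → g (i , j)))
    ≡⟨ ∑ˡ-tabulate id (λ i → ∑ˡ (allFin n) (λ j → g (i , j))) ⟩
  ∑[ i < n ] ∑ˡ (allFin n) (λ j → g (i , j))
    ≡⟨ sum-cong-≗ (λ i → ∑ˡ-tabulate id (λ j → g (i , j))) ⟩
  ∑[ i < n ] ∑[ j < n ] g (i , j) ∎
  where
  open ≡-Reasoning
  g : Fin n × Fin n → ℕ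
  g (i , j) = [ i <? j ]· f (i , j)

-- Splitting double sums along the diagonal.

∑-const : ∀ n x → ∑[ i < n ] x ≡ n * x
∑-const zero    x = refl
∑-const (suc n) x = cong (x +_) (∑-const n x)

∑-≟ : ∀ {n} i (f : Fin n → ℕ) → ∑[ j < n ] [ i ≟ j ]· f j ≡ f i
∑-≟ {suc n} zero    f = trans (cong (f zero +_) (sum-replicate-zero n)) (+-identityʳ (f zero))
-- The head term computes to 0, and `does (suc i ≟ suc j)` reduces to `does (i ≟ j)`.
∑-≟         (suc i) f = ∑-≟ i (f ∘ suc)

[]·-distrib-+ : ∀ {p} {P : Set p} (P? : Dec P) m n → [ P? ]· (m + n) ≡ [ P? ]· m + [ P? ]· n
[]·-distrib-+ P? m n with does P?
... | true  = refl
... | false = refl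

[]·-trichotomy : ∀ {n} (i j : Fin n) m → m ≡ [ i <? j ]· m + [ j <? i ]· m + [ i ≟ j ]· m
[]·-trichotomy i j m with <-cmp i j
... | tri< i<j i≢j j≮i
  rewrite dec-true (i <? j) i<j | dec-false (j <? i) j≮i | dec-false (i ≟ j) i≢j
  = sym (trans (+-identityʳ (m + 0)) (+-identityʳ m))
... | tri≈ i≮j i≡j j≮i
  rewrite dec-false (i <? j) i≮j | dec-false (j <? i) j≮i | dec-true (i ≟ j) i≡j
  = refl
... | tri> i≮j i≢j j<i
  rewrite dec-false (i <? j) i≮j | dec-true (j <? i) j<i | dec-false (i ≟ j) i≢j
  = sym (+-identityʳ m)

∑∑-pairs : ∀ n (f : Fin n → Fin n → ℕ) →
           ∑[ i < n ] ∑[ j < n ] f i j ≡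
           ∑ˡ (pairs n) (λ (i , j) → f i j + f j i) + ∑[ i < n ] f i i
∑∑-pairs n f = begin
  ∑[ i < n ] ∑[ j < n ] f i j
    ≡⟨ sum-cong-≗ (λ i → sum-cong-≗ (λ j → []·-trichotomy i j (f i j))) ⟩
  ∑[ i < n ] ∑[ j < n ] (below i j + above i j + diagonal i j)
    ≡⟨ ∑∑-distrib-+ (λ i j → below i j + above i j) diagonal ⟩
  ∑[ i < n ] ∑[ j < n ] (below i j + above i j) + ∑[ i < n ] ∑[ j < n ] diagonal i j
    ≡⟨ cong₂ _+_ off-diagonal (sum-cong-≗ (λ i → ∑-≟ i (f i))) ⟩
  ∑ˡ (pairs n) (λ (i , j) → f i j + f j i) + ∑[ i < n ] f i i ∎
  where
  open ≡-Reasoning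
  -- The names give the position of `i` relative to `j`.
  below above diagonal : Fin n → Fin n → ℕ
  below    i j = [ i <? j ]· f i j
  above    i j = [ j <? i ]· f i j
  diagonal i j = [ i ≟ j ]· f i j

  ∑∑-distrib-+ : ∀ (g h : Fin n → Fin n → ℕ) →
    ∑[ i < n ] ∑[ j < n ] (g i j + h i j) ≡
    ∑[ i < n ] ∑[ j < n ] g i j + ∑[ i < n ] ∑[ j < n ] h i j
  ∑∑-distrib-+ g h = trans
    (sum-cong-≗ (λ i → ∑-distrib-+ (g i) (h i)))
    (∑-distrib-+ (λ i → sum (g i)) (λ i → sum (h i)))

  off-diagonal : ∑[ i < n ] ∑[ j < n ] (below i j + above i j) ≡
                 ∑ˡ (pairs n) (λ (i , j) → f i j + f j i)
  off-diagonal = begin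
    ∑[ i < n ] ∑[ j < n ] (below i j + above i j)
      ≡⟨ ∑∑-distrib-+ below above ⟩
    ∑[ i < n ] ∑[ j < n ] below i j + ∑[ i < n ] ∑[ j < n ] above i j
      -- Exchanging the two sums transposes the terms with `j < i`, so both halves carry the
      -- indicator of `i < j` and can be merged.
      ≡⟨ cong (∑[ i < n ] ∑[ j < n ] below i j +_) (∑-comm above) ⟩
    ∑[ i < n ] ∑[ j < n ] below i j + ∑[ i < n ] ∑[ j < n ] above j i
      ≡⟨ ∑∑-distrib-+ below (λ i j → above j i) ⟨
    ∑[ i < n ] ∑[ j < n ] (below i j + above j i)
      ≡⟨ sum-cong-≗ (λ i → sum-cong-≗ (λ j → []·-distrib-+ (i <? j) (f i j) (f j i))) ⟨
    ∑[ i < n ] ∑[ j < n ] [ i <? j ]· (f i j + f j i)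
      ≡⟨ ∑ˡ-pairs n (λ (i , j) → f i j + f j i) ⟨
    ∑ˡ (pairs n) (λ (i , j) → f i j + f j i) ∎

-- Each index lies in `n ∸ 1` pairs: the full double sum of `f i` is `n * sum f`, and removing the
-- diagonal takes away one copy of `sum f`.
∑ˡ-pairs-+ : ∀ n (f : Fin n → ℕ) → ∑ˡ (pairs n) (λ (i , j) → f i + f j) ≡ (n ∸ 1) * sum f
∑ˡ-pairs-+ n f = begin
  ∑ˡ (pairs n) (λ (i , j) → f i + f j)
    ≡⟨ m+n∸n≡m _ (sum f) ⟨
  (∑ˡ (pairs n) (λ (i , j) → f i + f j) + sum f) ∸ sum f
    ≡⟨ cong (_∸ sum f) (∑∑-pairs n (λ i _ → f i)) ⟨
  (∑[ i < n ] ∑[ j < n ] f i) ∸ sum f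
    -- After the exchange the inner sum is the constant `sum f`.
    ≡⟨ cong (_∸ sum f) (trans (∑-comm {n} {n} (λ i _ → f i)) (∑-const n (sum f))) ⟩
  n * sum f ∸ sum f
    ≡⟨ n*m∸m n (sum f) ⟩
  (n ∸ 1) * sum f ∎
  where
  open ≡-Reasoning
  n*m∸m : ∀ n m → n * m ∸ m ≡ (n ∸ 1) * m
  -- For `n = 0` truncation makes both sides 0; `m` is split only to let `0 ∸ m` compute.
  n*m∸m zero    zero    = refl
  n*m∸m zero    (suc m) = refl
  n*m∸m (suc n) m       = trans (cong (_∸ m) (+-comm m (n * m))) (m+n∸n≡m (n * m) m)

-- The degree sum.

module _ {N} (G : SimpleGraph N) where
  open SimpleGraph G
  open ≡-Reasoning

  adjacency : Fin N → Fin N → ℕ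
  adjacency i j = [ i ~? j ]· 1

  adjacency-comm : ∀ i j → adjacency i j ≡ adjacency j i
  adjacency-comm i j with i ~? j | j ~? i
  ... | yes _   | yes _   = refl
  ... | no  _   | no  _   = refl
  ... | yes i~j | no  j≁i = contradiction (symm i~j) j≁i
  ... | no  i≁j | yes j~i = contradiction (symm j~i) i≁j

  degree-∑ : ∀ i → degree G i ≡ ∑[ j < N ] adjacency i j
  degree-∑ i = trans (length-filter-∑ˡ (i ~?_) (allFin N)) (∑ˡ-tabulate id (adjacency i))

  adjacency-irrefl : ∀ i → adjacency i i ≡ 0
  adjacency-irrefl i = cong (if_then 1 else 0) (dec-false (i ~? i) (irrefl refl))

  -- The double sum of the adjacency matrix meets each edge once from either end, and the diagonal
  -- vanishes because there are no loops.
  handshake : ∑[ i < N ] degree G i ≡ 2 * ∣E∣ G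
  handshake = begin
    ∑[ i < N ] degree G i
      ≡⟨ sum-cong-≗ degree-∑ ⟩
    ∑[ i < N ] ∑[ j < N ] adjacency i j
      ≡⟨ ∑∑-pairs N adjacency ⟩
    ∑ˡ (pairs N) (λ (i , j) → adjacency i j + adjacency j i) + ∑[ i < N ] adjacency i i
      ≡⟨ cong₂ _+_ (∑ˡ-cong (pairs N) (λ (i , j) → twice i j)) (sum-cong-≗ adjacency-irrefl) ⟩
    ∑ˡ (pairs N) (λ (i , j) → 2 * adjacency i j) + ∑[ i < N ] 0
      ≡⟨ cong (∑ˡ (pairs N) (λ (i , j) → 2 * adjacency i j) +_) (sum-replicate-zero N) ⟩
    ∑ˡ (pairs N) (λ (i , j) → 2 * adjacency i j) + 0
      ≡⟨ +-identityʳ _ ⟩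
    ∑ˡ (pairs N) (λ (i , j) → 2 * adjacency i j)
      ≡⟨ ∑ˡ-*ˡ 2 (uncurry adjacency) (pairs N) ⟩
    2 * ∑ˡ (pairs N) (uncurry adjacency)
      -- `edges G` is by definition `pairs N` filtered by adjacency.
      ≡⟨ cong (2 *_) (length-filter-∑ˡ (uncurry _~?_) (pairs N)) ⟨
    2 * ∣E∣ G ∎
    where
    twice : ∀ i j → adjacency i j + adjacency j i ≡ 2 * adjacency i j
    twice i j = cong (adjacency i j +_) (trans (adjacency-comm j i) (sym (+-identityʳ _)))

-- Passage to the rationals and the estimate.

-- Division by 1 goes through gcd normalisation, which is stuck on a variable `n`. The explicit
-- numerator and denominator let rational addition compute.
fromℕ-normal : ∀ n → fromℕ n ≡ mkℚ (ℤ.+ n) 0 (coprime-sym (1-coprimeTo n))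
fromℕ-normal n = ℚₚ.normalize-coprime (coprime-sym (1-coprimeTo n))

fromℕ-homo-+ : ∀ m n → fromℕ (m + n) ≡ fromℕ m ℚ.+ fromℕ n
fromℕ-homo-+ m n = begin
  fromℕ (m + n)
    ≡⟨ cong (ℚ._/ 1) (cong₂ ℤ._+_ (ℤₚ.*-identityʳ (ℤ.+ m)) (ℤₚ.*-identityʳ (ℤ.+ n))) ⟨
  (ℤ.+ m ℤ.* ℤ.1ℤ ℤ.+ ℤ.+ n ℤ.* ℤ.1ℤ) ℚ./ 1
    -- With both summands in `mkℚ` form, addition unfolds to the cross-multiplied fraction above.
    ≡⟨ cong₂ ℚ._+_ (fromℕ-normal m) (fromℕ-normal n) ⟨
  fromℕ m ℚ.+ fromℕ n ∎
  where open ≡-Reasoning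

fromℕ-nonNeg : ∀ n → ℚ.NonNegative (fromℕ n)
fromℕ-nonNeg n = ℚₚ.normalize-nonNeg n 1

-- The weights are accumulated in ℕ, so that their total can be found by counting.
foldr-+-≤ : ∀ {a} {A : Set a} (t : A → ℚ) (w : A → ℕ) M → (∀ x → t x ≤ fromℕ (w x) ℚ.* M) →
            ∀ xs → foldr ℚ._+_ 0ℚ (List.map t xs) ≤ fromℕ (∑ˡ xs w) ℚ.* M
foldr-+-≤ t w M t≤wM []       = ℚₚ.≤-reflexive (sym (ℚₚ.*-zeroˡ M))
foldr-+-≤ t w M t≤wM (x ∷ xs) = begin
  t x ℚ.+ foldr ℚ._+_ 0ℚ (List.map t xs)
    ≤⟨ ℚₚ.+-mono-≤ (t≤wM x) (foldr-+-≤ t w M t≤wM xs) ⟩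
  fromℕ (w x) ℚ.* M ℚ.+ fromℕ (∑ˡ xs w) ℚ.* M
    ≡⟨ ℚₚ.*-distribʳ-+ M (fromℕ (w x)) (fromℕ (∑ˡ xs w)) ⟨
  (fromℕ (w x) ℚ.+ fromℕ (∑ˡ xs w)) ℚ.* M
    ≡⟨ cong (ℚ._* M) (fromℕ-homo-+ (w x) (∑ˡ xs w)) ⟨
  fromℕ (w x + ∑ˡ xs w) ℚ.* M ∎
  where open ℚₚ.≤-Reasoning

theorem6 : ∀ {N : ℕ} (G : SimpleGraph N) (connected : Connected G) (R : ℚ) →
    IsMaximum (effectiveResistance G connected) R →
    R⁺ G connected ≤ fromℕ (2 * ∣E∣ G * (N ∸ 1)) ℚ.* R
theorem6 {N} G connected R (_ , Rᵢⱼ≤R) =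
  subst (λ w → R⁺ G connected ≤ fromℕ w ℚ.* R) total-weight
    -- The underscore is the summand local to `R⁺`, recovered by unification. Multiplying `Rᵢⱼ≤R` by
    -- a nonnegative weight bounds it.
    (foldr-+-≤ _ weight R
      (λ (i , j) → ℚₚ.*-monoˡ-≤-nonNeg (fromℕ (weight (i , j)))
        {{fromℕ-nonNeg (weight (i , j))}} (Rᵢⱼ≤R i j))
      (pairs N))
  where
  weight : Fin N × Fin N → ℕ
  weight (i , j) = degree G i + degree G j

  total-weight : ∑ˡ (pairs N) weight ≡ 2 * ∣E∣ G * (N ∸ 1)
  total-weight = trans (∑ˡ-pairs-+ N (degree G))
    (trans (cong ((N ∸ 1) *_) (handshake G)) (*-comm (N ∸ 1) (2 * ∣E∣ G)))
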